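{- Let $p$ be a prime and let $\chi$ be a multiplicative arithmetic function (not identically zero). Let $k\in\mathbb{N}\cup\{\infty\}$ and $\mathbf{t}=(t_1,t_2,\dots)$ (with $t_j=0$ for $j>k$ when $k$ is finite) be the parameters of the local core of $\chi$ at $p$, and let $\{F_{k,n}(\mathbf{t})\}_{n\ge 0}$ be the sequence of generalized Fibonacci polynomials evaluated at $\mathbf{t}$. Then for all $n\ge 0$, $$F_{k,n}(\mathbf{t})=\chi(p^n).$$
   Context: A multiplicative arithmetic function is a function $\chi:\mathbb{N}_{\geq 1}\to\mathbb{C}$, not identically zero, with $\chi(mn)=\chi(m)\chi(n)$ whenever $\gcd(m,n)=1$ (so $\chi(1)=1$). Dirichlet convolution is $(\alpha*\beta)(n)=\sum_{d\mid n}\alpha(d)\beta(n/d)$, and $\chi^{ -1}$ denotes the inverse of $\chi$ for convolution. Local core: for a prime $p$, the parameters of $\chi$ at $p$ are the numbers $t_j=-\chi^{ -1}(p^j)$, $j\ge 1$. If there is a finite $k$ with $t_k\ne 0$ and $t_j=0$ for $j>k$, the local core of $\chi$ is the polynomial $X^k-t_1X^{k-1}-\dots-t_k$ (with $k=0$ if all $t_j=0$); if infinitely many $t_j$ are non-zero, then $k=\infty$ and the core is the corresponding power series $1-\sum_{j\ge1}t_jy^j$. Generalized Fibonacci polynomials: $F_{k,0}=1$ and, for $n\ge1$, $$F_{k,n}(t_1,\dots,t_k)=\sum_{\alpha}\binom{|\alpha|}{\alpha_1,\dots,\alpha_k}t_1^{\alpha_1}\cdots t_k^{\alpha_k},$$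 the sum being over all $\alpha=(\alpha_1,\dots,\alpha_k)$ of non-negative integers with $\sum_j j\alpha_j=n$, where $|\alpha|=\sum_j\alpha_j$ and the coefficient is the multinomial coefficient. For $k=\infty$ one takes all finitely supported sequences $(\alpha_j)_{j\ge1}$ with $\sum_j j\alpha_j=n$ (so only $t_1,\dots,t_n$ occur). -}

module Defs where

open import Algebra.Apartness.Bundles using (HeytingCommutativeRing; HeytingField)
import Algebra.Apartness.Properties.HeytingCommutativeRing as HeytingProperties
open import Algebra.Bundles using (CommutativeRing)
import Algebra.Properties.CommutativeMonoid.Sum as Summation
import Algebra.Properties.Semiring.Exp as Exponentiation
import Algebra.Properties.Semiring.Mult as Multiples
import Algebra.Properties.Ring as RingProperties
open import Data.Empty using (⊥-elim)
open import Data.Fin.Base using (Fin; toℕ)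
open import Data.List.Base as List using (List; []; _∷_; upTo; cartesianProductWith; filter)
open import Data.Nat.Base as ℕ using (ℕ; zero; suc; NonZero; _<_; _!)
open import Data.Nat.Coprimality using (coprime⇒gcd≡1; 1-coprimeTo)
open import Data.Nat.DivMod using (_/_)
open import Data.Nat.Divisibility using (_∣_; _∣?_; quotient; quotient≢0; quotient-<; 1∣_)
open import Data.Nat.GCD using (gcd)
open import Data.Nat.Induction using (<-wellFounded)
open import Data.Nat.Primality using (Prime; prime⇒nonZero)
open import Data.Nat.Properties using (_≟_; m*n≢0; m^n≢0; _!≢0)
import Data.Nat.Properties as ℕ
open import Data.Product.Base using (∃; _,_)
open import Data.Sum.Base using (inj₁; inj₂)
open import Data.Vec.Base as Vec using (Vec; []; _∷_; lookup)
open import Induction.WellFounded using (Acc; acc)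
open import Level using (_⊔_)
open import Relation.Binary.PropositionalEquality.Core as ≡ using (_≡_)
import Relation.Binary.Reasoning.Setoid as SetoidReasoning
open import Relation.Nullary.Construct.Add.Supremum using (_⁺; [_]; ⊤⁺)
open import Relation.Nullary.Decidable.Core using (yes; no)
open import Relation.Nullary.Negation.Core using (¬_; contradiction)

-- A vector α : Vec ℕ k stands for (α₁,…,αₖ): αⱼ sits at index j − 1.

-- Σⱼ j αⱼ, where the head of the vector has index j.
weightFrom : ℕ → ∀ {k} → Vec ℕ k → ℕ
weightFrom j []       = 0
weightFrom j (a ∷ as) = j ℕ.* a ℕ.+ weightFrom (suc j) as

weight : ∀ {k} → Vec ℕ k → ℕ
weight = weightFrom 1

factorials : ∀ {k} → Vec ℕ k → ℕ
factorials []       = 1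
factorials (a ∷ as) = a ! ℕ.* factorials as

factorials≢0 : ∀ {k} (α : Vec ℕ k) → NonZero (factorials α)
factorials≢0 []       = _
factorials≢0 (a ∷ as) = m*n≢0 (a !) (factorials as) {{a !≢0}} {{factorials≢0 as}}

multinomial : ∀ {k} → Vec ℕ k → ℕ
multinomial α = _/_ (Vec.sum α !) (factorials α) {{factorials≢0 α}}

-- All vectors of length k with entries ≤ b, each listed once.
box : ∀ k → ℕ → List (Vec ℕ k)
box zero    b = [] ∷ []
box (suc k) b = cartesianProductWith _∷_ (upTo (suc b)) (box k b)

-- All α with Σⱼ j αⱼ = n, each listed once; the box loses nothing, since
-- αⱼ ≤ j αⱼ ≤ n.
exponents : ∀ k → ℕ → List (Vec ℕ k)
exponents k n = filter (λ α → weight α ≟ n) (box k n)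

-- K plays the role of ℂ, which the library lacks. Constructively ℂ is a Heyting
-- field; classically every field is one.
module Over {c ℓ₁ ℓ₂} (K : HeytingField c ℓ₁ ℓ₂) where

  open HeytingField K
  open HeytingCommutativeRing heytingCommutativeRing using (commutativeRing)
  open CommutativeRing commutativeRing using (ring; semiring; +-commutativeMonoid; *-commutativeMonoid)
  open Summation +-commutativeMonoid using (sum-syntax; sum-cong-≋)
  open Summation *-commutativeMonoid using () renaming (sum to product)
  open Exponentiation semiring using (_^_)
  open Multiples semiring using (_×_)

  ArithmeticFunction : Set c
  ArithmeticFunction = (n : ℕ) → .{{NonZero n}} → Carrier

  record IsMultiplicative (χ : ArithmeticFunction) : Set (c ⊔ ℓ₁) where
    field
      nonzero        : ¬ (∀ n → .{{_ : NonZero n}} → χ n ≈ 0#)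
      multiplicative : ∀ m n → .{{_ : NonZero m}} → .{{_ : NonZero n}} →
                       gcd m n ≡ 1 → χ (m ℕ.* n) {{m*n≢0 m n}} ≈ χ m * χ n

  divisorTerm : ArithmeticFunction → ArithmeticFunction →
                (n : ℕ) → .{{NonZero n}} → (d : ℕ) → .{{NonZero d}} → Carrier
  divisorTerm α β n d with d ∣? n
  ... | yes d∣n = α d * β (quotient d∣n) {{quotient≢0 d∣n}}
  ... | no  _   = 0#

  infixl 7 _∗_
  _∗_ : ArithmeticFunction → ArithmeticFunction → ArithmeticFunction
  (α ∗ β) n = ∑[ i < n ] divisorTerm α β n (suc (toℕ i))

  δ : ArithmeticFunction
  δ 1 = 1#
  δ _ = 0#

  -- One-sided, which suffices as _∗_ is commutative.
  IsConvolutionInverse : ArithmeticFunction → ArithmeticFunction → Set ℓ₁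
  IsConvolutionInverse χ χ⁻¹ = ∀ n → .{{_ : NonZero n}} → (χ ∗ χ⁻¹) n ≈ δ n

  atPrimePower : ArithmeticFunction → ∀ {p} → Prime p → ℕ → Carrier
  atPrimePower χ {p} pr n = χ (p ℕ.^ n) {{m^n≢0 p n {{prime⇒nonZero pr}}}}

  -- Meaningful for j ≥ 1 only; nothing below uses the value at j = 0.
  parameters : ArithmeticFunction → ∀ {p} → Prime p → ℕ → Carrier
  parameters χ⁻¹ pr j = - atPrimePower χ⁻¹ pr j

  -- The local core with parameters t₁, t₂, … is a polynomial of degree k …
  record IsPolynomialCore (t : ℕ → Carrier) (k : ℕ) : Set ℓ₁ where
    field
      leading : .{{NonZero k}} → ¬ (t k ≈ 0#)
      above   : ∀ j → k < j → t j ≈ 0#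

  -- … or a power series: infinitely many tⱼ are non-zero, in the weakest
  -- constructive form that no tail of the sequence vanishes.
  IsPowerSeriesCore : (ℕ → Carrier) → Set ℓ₁
  IsPowerSeriesCore t = ∀ N → ¬ (∀ j → N < j → t j ≈ 0#)

  -- The supremum ⊤⁺ added to ℕ is k = ∞.
  IsCoreDegree : (ℕ → Carrier) → ℕ ⁺ → Set ℓ₁
  IsCoreDegree t [ k ] = IsPolynomialCore t k
  IsCoreDegree t ⊤⁺    = IsPowerSeriesCore t

  monomial : ∀ {k} → (ℕ → Carrier) → Vec ℕ k → Carrier
  monomial t α = product λ i → t (suc (toℕ i)) ^ lookup α i

  sumOver : ∀ {a} {A : Set a} → List A → (A → Carrier) → Carrier
  sumOver xs f = List.foldr (λ x s → f x + s) 0# xs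

  -- If Σⱼ j αⱼ = n then αⱼ = 0 for j > n, so for k = ∞ the finitely supported
  -- sequences of weight n are exactly the vectors of length n and weight n.
  F : ℕ ⁺ → ℕ → (ℕ → Carrier) → Carrier
  F k     zero      t = 1#
  F [ k ] n@(suc _) t = sumOver (exponents k n) λ α → multinomial α × monomial t α
  F ⊤⁺    n@(suc _) t = sumOver (exponents n n) λ α → multinomial α × monomial t α

  module _ {χ : ArithmeticFunction} (mult : IsMultiplicative χ) where
    open IsMultiplicative mult
    open SetoidReasoning setoid
    open RingProperties ring using ([y-z]x≈yx-zx)
    open HeytingProperties heytingCommutativeRing using (1#0; x-0≈x)

    private
      cong : ∀ (α : ArithmeticFunction) {m n} → .{{_ : NonZero m}} → .{{_ : NonZero n}} → m ≡ n → α m ≈ α n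
      cong α ≡.refl = refl

      χn≈χ1*χn : ∀ n → .{{_ : NonZero n}} → χ n ≈ χ 1 * χ n
      χn≈χ1*χn n = trans (cong χ {{_}} {{m*n≢0 1 n}} (≡.sym (ℕ.*-identityˡ n)))
                         (multiplicative 1 n (coprime⇒gcd≡1 (1-coprimeTo n)))

    χ1≈1 : χ 1 ≈ 1#
    χ1≈1 with #-cotrans 1#0 (χ 1)
    ... | inj₁ 1#χ1 with #⇒invertible 1#χ1
    ...   | (u , u⁻¹*≈1 , _) = ⊥-elim (nonzero χn≈0)
      where
      [1-χ1]*χn≈0 : ∀ n → .{{_ : NonZero n}} → (1# - χ 1) * χ n ≈ 0#
      [1-χ1]*χn≈0 n = begin
        (1# - χ 1) * χ n          ≈⟨ [y-z]x≈yx-zx (χ n) 1# (χ 1) ⟩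
        1# * χ n - χ 1 * χ n      ≈⟨ +-cong (*-identityˡ (χ n)) (-‿cong (sym (χn≈χ1*χn n))) ⟩
        χ n - χ n                 ≈⟨ -‿inverseʳ (χ n) ⟩
        0#                        ∎
      χn≈0 : ∀ n → .{{_ : NonZero n}} → χ n ≈ 0#
      χn≈0 n = begin
        χ n                       ≈⟨ *-identityˡ (χ n) ⟨
        1# * χ n                  ≈⟨ *-congʳ u⁻¹*≈1 ⟨
        u * (1# - χ 1) * χ n      ≈⟨ *-assoc u _ _ ⟩
        u * ((1# - χ 1) * χ n)    ≈⟨ *-congˡ ([1-χ1]*χn≈0 n) ⟩
        u * 0#                    ≈⟨ zeroʳ u ⟩
        0#                        ∎
    χ1≈1 | inj₂ χ1#0 with #⇒invertible χ1#0
    ...   | (u , u*≈1 , _) = begin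
      χ 1                         ≈⟨ *-identityˡ (χ 1) ⟨
      1# * χ 1                    ≈⟨ *-congʳ u*χ1≈1 ⟨
      u * χ 1 * χ 1               ≈⟨ *-assoc u _ _ ⟩
      u * (χ 1 * χ 1)             ≈⟨ *-congˡ (χn≈χ1*χn 1) ⟨
      u * χ 1                     ≈⟨ u*χ1≈1 ⟩
      1#                          ∎
      where
      u*χ1≈1 : u * χ 1 ≈ 1#
      u*χ1≈1 = trans (*-congˡ (sym (x-0≈x (χ 1)))) u*≈1

    private
      module _ (m : ℕ) where
        n = suc m

        -- The terms of (χ ∗ χ⁻¹) n with d ≥ 2, in which χ⁻¹ is only needed below n.
        laterTerm : (∀ q → .{{NonZero q}} → q < n → Carrier) → Fin m → Carrier
        laterTerm ψ i with suc (suc (toℕ i)) ∣? n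
        ... | yes d∣n = χ (suc (suc (toℕ i))) * ψ (quotient d∣n) {{quotient≢0 d∣n}} (quotient-< d∣n)
        ... | no  _   = 0#

        laterTerm-cong : ∀ ψ ψ′ → (∀ q .{{_ : NonZero q}} q<n → ψ q q<n ≈ ψ′ q q<n) →
                         ∀ i → laterTerm ψ i ≈ laterTerm ψ′ i
        laterTerm-cong ψ ψ′ ψ≈ψ′ i with suc (suc (toℕ i)) ∣? n
        ... | yes d∣n = *-congˡ (ψ≈ψ′ (quotient d∣n) {{quotient≢0 d∣n}} (quotient-< d∣n))
        ... | no  _   = refl

        laterTerm-divisorTerm : ∀ (β : ArithmeticFunction) i →
          laterTerm (λ q _ → β q) i ≈ divisorTerm χ β n (suc (suc (toℕ i)))
        laterTerm-divisorTerm β i with suc (suc (toℕ i)) ∣? n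
        ... | yes d∣n = refl
        ... | no  _   = refl

      firstTerm : ∀ (β : ArithmeticFunction) n → .{{_ : NonZero n}} → divisorTerm χ β n 1 ≈ β n
      firstTerm β n with 1 ∣? n
      ... | no  1∤n = contradiction (1∣ n) 1∤n
      ... | yes 1∣n = trans (*-congʳ χ1≈1) (trans (*-identityˡ _)
        (cong β {{quotient≢0 1∣n}} (≡.trans (≡.sym (ℕ.*-identityʳ _)) (≡.sym (_∣_.equality 1∣n)))))

      -- (χ ∗ χ⁻¹) n ≈ δ n, solved for χ⁻¹ n.
      inv : ∀ n → .{{NonZero n}} → Acc _<_ n → Carrier
      inv (suc m) (acc rs) = δ (suc m) - ∑[ i < m ] laterTerm m (λ q q<n → inv q (rs q<n)) i

      inv-irrelevant : ∀ n → .{{_ : NonZero n}} → (a b : Acc _<_ n) → inv n a ≈ inv n b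
      inv-irrelevant (suc m) (acc rs) (acc rs′) = +-congˡ (-‿cong (sum-cong-≋
        (laterTerm-cong m _ _ λ q q<n → inv-irrelevant q (rs q<n) (rs′ q<n))))

    inverse-exists : ∃ (IsConvolutionInverse χ)
    inverse-exists = χ⁻¹ , isInverse
      where
      χ⁻¹ : ArithmeticFunction
      χ⁻¹ n = inv n (<-wellFounded n)

      later : ∀ m → Carrier
      later m = ∑[ i < m ] divisorTerm χ χ⁻¹ (suc m) (suc (suc (toℕ i)))

      unfold : ∀ m → (a : Acc _<_ (suc m)) → inv (suc m) a ≈ δ (suc m) - later m
      unfold m (acc rs) = +-congˡ (-‿cong (sum-cong-≋ λ i → trans
        (laterTerm-cong m _ _ (λ q q<n → inv-irrelevant q (rs q<n) (<-wellFounded q)) i)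
        (laterTerm-divisorTerm m χ⁻¹ i)))

      isInverse : IsConvolutionInverse χ χ⁻¹
      isInverse (suc m) = begin
        divisorTerm χ χ⁻¹ (suc m) 1 + later m ≈⟨ +-congʳ (firstTerm χ⁻¹ (suc m)) ⟩
        χ⁻¹ (suc m) + later m                 ≈⟨ +-congʳ (unfold m (<-wellFounded (suc m))) ⟩
        δ (suc m) - later m + later m         ≈⟨ +-assoc _ _ _ ⟩
        δ (suc m) + (- later m + later m)     ≈⟨ +-congˡ (-‿inverseˡ (later m)) ⟩
        δ (suc m) + 0#                        ≈⟨ +-identityʳ _ ⟩
        δ (suc m)                             ∎

{-# OPTIONS --safe #-}

-- Both sides satisfy xₙ = t₁ xₙ₋₁ + … + tₙ x₀ with x₀ = 1. For χ(pⁿ) this is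
-- (χ ∗ χ⁻¹)(pⁿ) = 0. For the Fibonacci polynomials it is Pascal's rule for
-- multinomial coefficients: removing one unit from αᵢ splits off a factor tᵢ and
-- lowers the weight by i.

module Submission where

open import Algebra.Apartness.Bundles using (HeytingCommutativeRing; HeytingField)
open import Algebra.Bundles using (CommutativeRing)
import Algebra.Properties.CommutativeSemigroup as CommutativeSemigroupProperties
import Algebra.Properties.Group as GroupProperties
import Algebra.Properties.Semiring.Mult as Multiples
import Algebra.Properties.Semiring.Sum as Summation
open import Data.Fin.Base using (Fin; zero; suc; toℕ; opposite)
open import Data.Fin.Permutation using (reverse)
open import Data.Fin.Properties using (toℕ<n; opposite-prop)
open import Data.List.Base using (List; []; _∷_; _++_; map; applyUpTo; cartesianProductWith; filter)
open import Data.Nat.Base as ℕ using (ℕ; zero; suc; pred; NonZero; _∸_; _≤_; _<_; z≤n; s≤s; z<s; s<s; s≤s⁻¹; _!; nonTrivial⇒n>1; >-nonZero)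
open import Data.Nat.Combinatorics using (k![n∸k]!∣n!)
open import Data.Nat.Divisibility using (_∣_; _∣?_; divides; divides-refl; quotient; quotient≢0; ∣-trans; *-monoʳ-∣; ∣-refl)
open import Data.Nat.DivMod using (m/n*n≡m)
open import Data.Nat.Induction using (<-rec)
open import Data.Nat.Primality using (Prime; prime⇒nonZero; prime⇒nonTrivial; euclidsLemma)
open import Data.Nat.Properties using (_≟_; _≤?_; m^n≢0)
import Data.Nat.Properties as ℕ
open import Data.Product.Base using (∃; _,_)
open import Data.Sum.Base using (_⊎_; inj₁; inj₂)
open import Data.Vec.Base as Vec using (Vec; []; _∷_; lookup; updateAt; replicate)
open import Data.Vec.Properties using (lookup∘updateAt; updateAt-updateAt; updateAt-id)
open import Function.Base using (_∘_; id)
open import Level using (Level)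
open import Relation.Binary.PropositionalEquality as ≡ using (_≡_; _≢_)
import Relation.Binary.Reasoning.Setoid as SetoidReasoning
open import Relation.Nullary.Construct.Add.Supremum using (_⁺; [_]; ⊤⁺)
open import Relation.Nullary.Decidable.Core using (Dec; yes; no)
open import Relation.Nullary.Negation.Core using (¬_; contradiction)
open import Relation.Unary using (Pred; Decidable)
open import Defs

module ℕ-Sum = Summation ℕ.+-*-semiring

-- Raising one entry of an exponent vector: effect on the entry sum and the weight.

_[_]+1 : ∀ {k} → Vec ℕ k → Fin k → Vec ℕ k
α [ i ]+1 = updateAt α i suc

-- Replaces subtraction of a unit from entry `i`: either there is nothing to remove, or `α` is a
-- raised `β` and the raising lemmas apply.
zero-or-raised : ∀ {k} (α : Vec ℕ k) i → lookup α i ≡ 0 ⊎ ∃ λ β → α ≡ β [ i ]+1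
zero-or-raised (zero  ∷ α) zero = inj₁ ≡.refl
zero-or-raised (suc a ∷ α) zero = inj₂ (a ∷ α , ≡.refl)
zero-or-raised (a ∷ α) (suc i) with zero-or-raised α i
... | inj₁ αᵢ≡0       = inj₁ αᵢ≡0
... | inj₂ (β , α≡β+) = inj₂ (a ∷ β , ≡.cong (a ∷_) α≡β+)

sum-raise : ∀ {k} (α : Vec ℕ k) i → Vec.sum (α [ i ]+1) ≡ suc (Vec.sum α)
sum-raise (a ∷ α) zero    = ≡.refl
sum-raise (a ∷ α) (suc i) = ≡.trans (≡.cong (a ℕ.+_) (sum-raise α i)) (ℕ.+-suc a _)

weightFrom-raise : ∀ j {k} (α : Vec ℕ k) i → weightFrom j (α [ i ]+1) ≡ j ℕ.+ toℕ i ℕ.+ weightFrom j α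
weightFrom-raise j (a ∷ α) zero = begin
  j ℕ.* suc a ℕ.+ w          ≡⟨ ≡.cong (ℕ._+ w) (ℕ.*-suc j a) ⟩
  j ℕ.+ j ℕ.* a ℕ.+ w        ≡⟨ ℕ.+-assoc j _ w ⟩
  j ℕ.+ (j ℕ.* a ℕ.+ w)      ≡⟨ ≡.cong (ℕ._+ (j ℕ.* a ℕ.+ w)) (ℕ.+-identityʳ j) ⟨
  j ℕ.+ 0 ℕ.+ (j ℕ.* a ℕ.+ w) ∎
  where
  open ≡.≡-Reasoning
  w = weightFrom (suc j) α
weightFrom-raise j (a ∷ α) (suc i) = begin
  j ℕ.* a ℕ.+ weightFrom (suc j) (α [ i ]+1)  ≡⟨ ≡.cong (j ℕ.* a ℕ.+_) (weightFrom-raise (suc j) α i) ⟩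
  j ℕ.* a ℕ.+ (suc j ℕ.+ toℕ i ℕ.+ w)         ≡⟨ x∙yz≈y∙xz (j ℕ.* a) _ w ⟩
  suc j ℕ.+ toℕ i ℕ.+ (j ℕ.* a ℕ.+ w)         ≡⟨ ≡.cong (ℕ._+ (j ℕ.* a ℕ.+ w)) (ℕ.+-suc j (toℕ i)) ⟨
  j ℕ.+ suc (toℕ i) ℕ.+ (j ℕ.* a ℕ.+ w)       ∎
  where
  open ≡.≡-Reasoning
  open CommutativeSemigroupProperties ℕ.+-commutativeSemigroup using (x∙yz≈y∙xz)
  w = weightFrom (suc j) α

-- Each entry is multiplied by an index of at least 1. Hence a vector of weight at most `b` never
-- leaves the box with entries up to `b`.
lookup≤weightFrom : ∀ j .{{_ : NonZero j}} {k} (α : Vec ℕ k) i → lookup α i ≤ weightFrom j α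
lookup≤weightFrom j (a ∷ α) zero    = ℕ.≤-trans (ℕ.m≤n*m a j) (ℕ.m≤m+n _ _)
lookup≤weightFrom j (a ∷ α) (suc i) = ℕ.≤-trans (lookup≤weightFrom (suc j) α i) (ℕ.m≤n+m _ _)

weightFrom≡0⇒zeros : ∀ j .{{_ : NonZero j}} {k} (α : Vec ℕ k) → weightFrom j α ≡ 0 → α ≡ replicate k 0
weightFrom≡0⇒zeros j []      _  = ≡.refl
weightFrom≡0⇒zeros j (a ∷ α) eq = ≡.cong₂ _∷_
  (ℕ.n≤0⇒n≡0 (≡.subst (a ≤_) eq (lookup≤weightFrom j (a ∷ α) zero)))
  (weightFrom≡0⇒zeros (suc j) α (ℕ.m+n≡0⇒n≡0 (j ℕ.* a) eq))

weightFrom-zeros : ∀ j k → weightFrom j (replicate k 0) ≡ 0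
weightFrom-zeros j zero    = ≡.refl
weightFrom-zeros j (suc k) = ≡.cong₂ ℕ._+_ (ℕ.*-zeroʳ j) (weightFrom-zeros (suc j) k)

-- Provides the `s` that Pascal's rule asks for: a positive weight needs a positive entry.
weightFrom≢0⇒sum≢0 : ∀ j {k} (α : Vec ℕ k) {n} → weightFrom j α ≡ suc n → ∃ λ s → Vec.sum α ≡ suc s
weightFrom≢0⇒sum≢0 j (suc a ∷ α) _  = _ , ≡.refl
weightFrom≢0⇒sum≢0 j (zero  ∷ α) eq =
  weightFrom≢0⇒sum≢0 (suc j) α (≡.trans (≡.cong (ℕ._+ weightFrom (suc j) α) (≡.sym (ℕ.*-zeroʳ j))) eq)

-- Multinomial coefficients and Pascal's rule.

factorials-raise : ∀ {k} (α : Vec ℕ k) i → factorials (α [ i ]+1) ≡ suc (lookup α i) ℕ.* factorials α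
factorials-raise (a ∷ α) zero    = ℕ.*-assoc (suc a) (a !) (factorials α)
factorials-raise (a ∷ α) (suc i) = ≡.trans (≡.cong (a ! ℕ.*_) (factorials-raise α i))
                                           (x∙yz≈y∙xz (a !) (suc (lookup α i)) (factorials α))
  where open CommutativeSemigroupProperties ℕ.*-commutativeSemigroup using (x∙yz≈y∙xz)

-- Makes the integer division in `multinomial` exact. By induction the factorials of the tail divide
-- `s !`, where `s` is the tail's sum, and `a ! * s !` divides `(a + s) !` because binomial
-- coefficients are integers.
factorials∣sum! : ∀ {k} (α : Vec ℕ k) → factorials α ∣ Vec.sum α !
factorials∣sum! []      = ∣-refl
factorials∣sum! (a ∷ α) = ∣-trans (*-monoʳ-∣ (a !) (factorials∣sum! α))
  (≡.subst (λ s → a ! ℕ.* s ! ∣ (a ℕ.+ Vec.sum α) !) (ℕ.m+n∸m≡n a (Vec.sum α)) (k![n∸k]!∣n! (ℕ.m≤m+n a _)))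

multinomial*factorials : ∀ {k} (α : Vec ℕ k) → multinomial α ℕ.* factorials α ≡ Vec.sum α !
multinomial*factorials α = m/n*n≡m {{factorials≢0 α}} (factorials∣sum! α)

factorials-zeros : ∀ k → factorials (replicate k 0) ≡ 1
factorials-zeros zero    = ≡.refl
factorials-zeros (suc k) = ≡.trans (ℕ.*-identityˡ _) (factorials-zeros k)

sum-zeros : ∀ k → Vec.sum (replicate k 0) ≡ 0
sum-zeros zero    = ≡.refl
sum-zeros (suc k) = sum-zeros k

multinomial-zeros : ∀ k → multinomial (replicate k 0) ≡ 1
multinomial-zeros k = begin
  multinomial 0ᵏ                     ≡⟨ ℕ.*-identityʳ _ ⟨
  multinomial 0ᵏ ℕ.* 1               ≡⟨ ≡.cong (multinomial 0ᵏ ℕ.*_) (factorials-zeros k) ⟨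
  multinomial 0ᵏ ℕ.* factorials 0ᵏ   ≡⟨ multinomial*factorials 0ᵏ ⟩
  Vec.sum 0ᵏ !                       ≡⟨ ≡.cong _! (sum-zeros k) ⟩
  1                                  ∎
  where
  open ≡.≡-Reasoning
  0ᵏ = replicate k 0

-- The summand of Pascal's rule that belongs to index `i`. The value 0 at a zero entry has to be set
-- separately, since `pred` would leave such a vector unchanged.
multinomialBelow : ∀ {k} → Vec ℕ k → Fin k → ℕ
multinomialBelow α i with lookup α i
... | zero  = 0
... | suc _ = multinomial (updateAt α i pred)

multinomialBelow-zero : ∀ {k} (α : Vec ℕ k) i → lookup α i ≡ 0 → multinomialBelow α i ≡ 0
multinomialBelow-zero α i αᵢ≡0 with lookup α i
... | zero = ≡.refl

multinomialBelow-raise : ∀ {k} (α : Vec ℕ k) i → multinomialBelow (α [ i ]+1) i ≡ multinomial α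
multinomialBelow-raise α i with lookup (α [ i ]+1) i in eq
... | zero  = contradiction (≡.trans (≡.sym (lookup∘updateAt i α)) eq) λ ()
... | suc _ = ≡.cong multinomial (≡.trans (updateAt-updateAt i α) (updateAt-id i α))

-- Both sides vanish if entry `i` is zero. Otherwise `α` is `β [ i ]+1`: raising multiplies the
-- factorials by the new entry, and the multinomial of `β` times its factorials is `s !`, because
-- the entries of `β` add up to `s`.
multinomialBelow*factorials : ∀ {k} (α : Vec ℕ k) s → Vec.sum α ≡ suc s → ∀ i →
  multinomialBelow α i ℕ.* factorials α ≡ lookup α i ℕ.* s !
multinomialBelow*factorials α s Σα≡1+s i with zero-or-raised α i
... | inj₁ αᵢ≡0 = ≡.trans (≡.cong (ℕ._* factorials α) (multinomialBelow-zero α i αᵢ≡0))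
                          (≡.sym (≡.cong (ℕ._* s !) αᵢ≡0))
... | inj₂ (β , ≡.refl) = begin
  multinomialBelow (β [ i ]+1) i ℕ.* factorials (β [ i ]+1)  ≡⟨ ≡.cong₂ ℕ._*_ (multinomialBelow-raise β i) (factorials-raise β i) ⟩
  multinomial β ℕ.* (suc (lookup β i) ℕ.* factorials β)      ≡⟨ x∙yz≈y∙xz (multinomial β) (suc (lookup β i)) _ ⟩
  suc (lookup β i) ℕ.* (multinomial β ℕ.* factorials β)      ≡⟨ ≡.cong₂ ℕ._*_ (≡.sym (lookup∘updateAt i β)) (multinomial*factorials β) ⟩
  lookup (β [ i ]+1) i ℕ.* Vec.sum β !                       ≡⟨ ≡.cong (λ m → lookup (β [ i ]+1) i ℕ.* m !) (ℕ.suc-injective (≡.trans (≡.sym (sum-raise β i)) Σα≡1+s)) ⟩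
  lookup (β [ i ]+1) i ℕ.* s !                               ∎
  where
  open ≡.≡-Reasoning
  open CommutativeSemigroupProperties ℕ.*-commutativeSemigroup using (x∙yz≈y∙xz)

sum-lookup : ∀ {k} (α : Vec ℕ k) → ℕ-Sum.sum (lookup α) ≡ Vec.sum α
sum-lookup []      = ≡.refl
sum-lookup (a ∷ α) = ≡.cong (a ℕ.+_) (sum-lookup α)

-- After multiplication by the factorials this reads (1 + s)! = (Σ αᵢ) · s!.
multinomial-pascal : ∀ {k} (α : Vec ℕ k) s → Vec.sum α ≡ suc s → multinomial α ≡ ℕ-Sum.sum (multinomialBelow α)
multinomial-pascal α s Σα≡ = ℕ.*-cancelʳ-≡ _ _ (factorials α) {{factorials≢0 α}} (begin
  multinomial α ℕ.* factorials α                               ≡⟨ multinomial*factorials α ⟩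
  Vec.sum α !                                                  ≡⟨ ≡.cong _! Σα≡ ⟩
  suc s ℕ.* s !                                                ≡⟨ ≡.cong (ℕ._* s !) (≡.trans (sum-lookup α) Σα≡) ⟨
  ℕ-Sum.sum (lookup α) ℕ.* s !                                 ≡⟨ ℕ-Sum.*-distribʳ-sum (s !) (lookup α) ⟩
  ℕ-Sum.sum (λ i → lookup α i ℕ.* s !)                         ≡⟨ ℕ-Sum.sum-cong-≗ (multinomialBelow*factorials α s Σα≡) ⟨
  ℕ-Sum.sum (λ i → multinomialBelow α i ℕ.* factorials α)      ≡⟨ ℕ-Sum.*-distribʳ-sum (factorials α) (multinomialBelow α) ⟨
  ℕ-Sum.sum (multinomialBelow α) ℕ.* factorials α              ∎)
  where open ≡.≡-Reasoning

-- Divisors of prime powers.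

-- Induction on `n`: by Euclid's lemma `p` divides `d` or `q`, and one factor `p` is cancelled
-- there. Taking it from `d` raises the exponent found by one; taking it from `q` leaves `d` as it
-- is.
divisor-of-prime-power : ∀ {p} → Prime p → ∀ n d q → d ℕ.* q ≡ p ℕ.^ n → ∃ λ j → d ≡ p ℕ.^ j
divisor-of-prime-power pr zero d q dq≡1 = 0 , ℕ.m*n≡1⇒m≡1 d q dq≡1
divisor-of-prime-power {p} pr (suc n) d q dq≡ppⁿ
  with euclidsLemma d q pr (divides (p ℕ.^ n) (≡.trans dq≡ppⁿ (ℕ.*-comm p _)))
... | inj₁ (divides-refl e) =
  let j , e≡pʲ = divisor-of-prime-power pr n e q (ℕ.*-cancelˡ-≡ _ _ p {{prime⇒nonZero pr}} (begin
        p ℕ.* (e ℕ.* q)  ≡⟨ ℕ.*-assoc p e q ⟨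
        p ℕ.* e ℕ.* q    ≡⟨ ≡.cong (ℕ._* q) (ℕ.*-comm p e) ⟩
        e ℕ.* p ℕ.* q    ≡⟨ dq≡ppⁿ ⟩
        p ℕ.* p ℕ.^ n    ∎))
  in suc j , ≡.trans (ℕ.*-comm e p) (≡.cong (p ℕ.*_) e≡pʲ)
  where open ≡.≡-Reasoning
... | inj₂ (divides-refl e) = divisor-of-prime-power pr n d e (ℕ.*-cancelʳ-≡ _ _ p {{prime⇒nonZero pr}} (begin
        d ℕ.* e ℕ.* p    ≡⟨ ℕ.*-assoc d e p ⟩
        d ℕ.* (e ℕ.* p)  ≡⟨ dq≡ppⁿ ⟩
        p ℕ.* p ℕ.^ n    ≡⟨ ℕ.*-comm p _ ⟩
        p ℕ.^ n ℕ.* p    ∎))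
  where open ≡.≡-Reasoning

-- Powers of `p` are monotone in the exponent, so `m` being the power with exponent `j` would force
-- `n < j < suc n`.
between-powers : ∀ {p} → 1 < p → ∀ {n m} → p ℕ.^ n < m → m < p ℕ.^ suc n → ∀ j → m ≢ p ℕ.^ j
between-powers {p} 1<p {n} pⁿ<m m<p¹⁺ⁿ j ≡.refl = ℕ.<⇒≱ (exponent-< n j pⁿ<m) (s≤s⁻¹ (exponent-< j (suc n) m<p¹⁺ⁿ))
  where
  exponent-< : ∀ i j → p ℕ.^ i < p ℕ.^ j → i < j
  exponent-< i j pⁱ<pʲ = ℕ.≰⇒> λ j≤i → ℕ.<⇒≱ pⁱ<pʲ (ℕ.^-monoʳ-≤ p {{>-nonZero (ℕ.<-trans z<s 1<p)}} j≤i)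

module _ {c ℓ₁ ℓ₂} (K : HeytingField c ℓ₁ ℓ₂) where

  open HeytingField K hiding (zero)
  open HeytingCommutativeRing heytingCommutativeRing using (commutativeRing)
  open CommutativeRing commutativeRing using (semiring; *-commutativeSemigroup; +-group)
  open GroupProperties +-group using () renaming (∙-cancelʳ to +-cancelʳ)
  open Multiples semiring using (×-congʳ; ×-congˡ; ×-homo-+; ×-comm-*) renaming (_×_ to _·_)
  open Summation semiring
  open CommutativeSemigroupProperties *-commutativeSemigroup using (x∙yz≈y∙xz)
  open SetoidReasoning setoid
  open Over K

  private variable
    a b : Level
    A : Set a

  -- Summands with side conditions, and finite sums.

  infixl 5 _when_
  -- Turns a restriction on the summation index into zero summands, so that sums with different
  -- restrictions share one index set and can be compared term by term.
  _when_ : {P : Set a} → Carrier → Dec P → Carrier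
  x when yes _ = x
  x when no  _ = 0#

  when-no : {P : Set a} (P? : Dec P) {x : Carrier} → ¬ P → x when P? ≈ 0#
  when-no (yes p) ¬p = contradiction p ¬p
  when-no (no  _) ¬p = refl

  when-zero : {P : Set a} (P? : Dec P) {x : Carrier} → (P → x ≈ 0#) → x when P? ≈ 0#
  when-zero (yes p) x≈0 = x≈0 p
  when-zero (no  _) x≈0 = refl

  when-cong : {P : Set a} {Q : Set b} (P? : Dec P) (Q? : Dec Q) {x y : Carrier} →
              (P → Q) → (Q → P) → (P → x ≈ y) → x when P? ≈ y when Q?
  when-cong (yes p) (yes q) P⇒Q Q⇒P x≈y = x≈y p
  when-cong (yes p) (no ¬q) P⇒Q Q⇒P x≈y = contradiction (P⇒Q p) ¬q
  when-cong (no ¬p) (yes q) P⇒Q Q⇒P x≈y = contradiction (Q⇒P q) ¬p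
  when-cong (no ¬p) (no ¬q) P⇒Q Q⇒P x≈y = refl

  *-when : {P : Set a} (P? : Dec P) (x y : Carrier) → x * y when P? ≈ x * (y when P?)
  *-when (yes _) x y = refl
  *-when (no  _) x y = sym (zeroʳ x)

  ∑-when : {P : Set a} (P? : Dec P) {n : ℕ} (f : Fin n → Carrier) → sum f when P? ≈ ∑[ i < n ] (f i when P?)
  ∑-when (yes _) f = refl
  ∑-when (no  _) {n} f = sym (sum-replicate-zero n)

  ∑-zero : ∀ {n} (f : Fin n → Carrier) → (∀ i → f i ≈ 0#) → sum f ≈ 0#
  ∑-zero {n} f f≈0 = trans (sum-cong-≋ f≈0) (sum-replicate-zero n)

  ∑-suc : ∀ n (g : ℕ → Carrier) → ∑[ i < suc n ] g (toℕ i) ≈ ∑[ i < n ] g (toℕ i) + g n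
  ∑-suc zero    g = +-comm _ _
  ∑-suc (suc n) g = trans (+-congˡ (∑-suc n (g ∘ suc))) (sym (+-assoc _ _ _))

  ∑-truncate : ∀ {m n} (g : ℕ → Carrier) → m ≤ n → (∀ i → m ≤ i → i < n → g i ≈ 0#) →
               ∑[ i < n ] g (toℕ i) ≈ ∑[ i < m ] g (toℕ i)
  ∑-truncate {n = n} g z≤n g≈0 = ∑-zero {n} _ λ i → g≈0 (toℕ i) z≤n (toℕ<n i)
  ∑-truncate g (s≤s m≤n) g≈0 = +-congˡ (∑-truncate (g ∘ suc) m≤n λ i m≤i i<n → g≈0 (suc i) (s≤s m≤i) (s<s i<n))

  -- The sum over indices 0 to `n` can be split at either end, and both end terms vanish.
  ∑-shift : ∀ n (g : ℕ → Carrier) → g 0 ≈ 0# → g n ≈ 0# → ∑[ i < n ] g (toℕ i) ≈ ∑[ i < n ] g (suc (toℕ i))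
  ∑-shift n g g0≈0 gn≈0 = begin
    ∑[ i < n ] g (toℕ i)              ≈⟨ +-identityʳ _ ⟨
    ∑[ i < n ] g (toℕ i) + 0#         ≈⟨ +-congˡ gn≈0 ⟨
    ∑[ i < n ] g (toℕ i) + g n        ≈⟨ ∑-suc n g ⟨
    g 0 + ∑[ i < n ] g (suc (toℕ i))  ≈⟨ +-congʳ g0≈0 ⟩
    0# + ∑[ i < n ] g (suc (toℕ i))   ≈⟨ +-identityˡ _ ⟩
    ∑[ i < n ] g (suc (toℕ i))        ∎

  ·-∑ : ∀ {n} (f : Fin n → ℕ) x → ℕ-Sum.sum f · x ≈ ∑[ i < n ] (f i · x)
  ·-∑ {zero}  f x = refl
  ·-∑ {suc n} f x = trans (×-homo-+ x (f zero) _) (+-congˡ (·-∑ (f ∘ suc) x))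

  sumOver-cong : (xs : List A) {f g : A → Carrier} → (∀ x → f x ≈ g x) → sumOver xs f ≈ sumOver xs g
  sumOver-cong []       f≈g = refl
  sumOver-cong (x ∷ xs) f≈g = +-cong (f≈g x) (sumOver-cong xs f≈g)

  sumOver-zero : (xs : List A) {f : A → Carrier} → (∀ x → f x ≈ 0#) → sumOver xs f ≈ 0#
  sumOver-zero []       f≈0 = refl
  sumOver-zero (x ∷ xs) f≈0 = trans (+-cong (f≈0 x) (sumOver-zero xs f≈0)) (+-identityˡ 0#)

  sumOver-∑ : (xs : List A) {n : ℕ} (f : Fin n → A → Carrier) →
              sumOver xs (λ x → ∑[ i < n ] f i x) ≈ ∑[ i < n ] sumOver xs (f i)
  sumOver-∑ []       {n} f = sym (sum-replicate-zero n)
  sumOver-∑ (x ∷ xs) f = trans (+-congˡ (sumOver-∑ xs f)) (sym (∑-distrib-+ (λ i → f i x) (λ i → sumOver xs (f i))))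

  sumOver-* : (xs : List A) (y : Carrier) (f : A → Carrier) → sumOver xs (λ x → y * f x) ≈ y * sumOver xs f
  sumOver-* []       y f = sym (zeroʳ y)
  sumOver-* (x ∷ xs) y f = trans (+-congˡ (sumOver-* xs y f)) (sym (distribˡ y (f x) _))

  sumOver-filter : {P : Pred A b} (P? : Decidable P) (xs : List A) (f : A → Carrier) →
                   sumOver (filter P? xs) f ≈ sumOver xs (λ x → f x when P? x)
  sumOver-filter P? []       f = refl
  sumOver-filter P? (x ∷ xs) f with P? x
  ... | yes _ = +-congˡ (sumOver-filter P? xs f)
  ... | no  _ = trans (sumOver-filter P? xs f) (sym (+-identityˡ _))

  sumOver-applyUpTo : (g : ℕ → A) (n : ℕ) (f : A → Carrier) →
                      sumOver (applyUpTo g n) f ≈ ∑[ i < n ] f (g (toℕ i))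
  sumOver-applyUpTo g zero    f = refl
  sumOver-applyUpTo g (suc n) f = +-congˡ (sumOver-applyUpTo (g ∘ suc) n f)

  sumOver-++ : (xs ys : List A) (f : A → Carrier) → sumOver (xs ++ ys) f ≈ sumOver xs f + sumOver ys f
  sumOver-++ []       ys f = sym (+-identityˡ _)
  sumOver-++ (x ∷ xs) ys f = trans (+-congˡ (sumOver-++ xs ys f)) (sym (+-assoc _ _ _))

  sumOver-map : {B : Set b} (g : A → B) (xs : List A) (f : B → Carrier) → sumOver (map g xs) f ≈ sumOver xs (f ∘ g)
  sumOver-map g []       f = refl
  sumOver-map g (x ∷ xs) f = +-congˡ (sumOver-map g xs f)

  sumOver-cartesianProductWith : ∀ {b′} {B : Set b} {C : Set b′} (g : A → B → C) xs ys (f : C → Carrier) →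
    sumOver (cartesianProductWith g xs ys) f ≈ sumOver xs (λ x → sumOver ys (λ y → f (g x y)))
  sumOver-cartesianProductWith g []       ys f = refl
  sumOver-cartesianProductWith g (x ∷ xs) ys f = trans (sumOver-++ (map (g x) ys) _ f)
    (+-cong (sumOver-map (g x) ys f) (sumOver-cartesianProductWith g xs ys f))

  -- Sums over boxes of exponent vectors.

  sumOver-box : ∀ k b (h : Vec ℕ (suc k) → Carrier) →
                sumOver (box (suc k) b) h ≈ ∑[ a < suc b ] sumOver (box k b) (λ α → h (toℕ a ∷ α))
  sumOver-box k b h = trans (sumOver-cartesianProductWith _∷_ (applyUpTo id (suc b)) (box k b) h)
    (sumOver-applyUpTo id (suc b) _)

  sumOver-box-zeros : ∀ k b (h : Vec ℕ k → Carrier) → (∀ α → α ≢ replicate k 0 → h α ≈ 0#) →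
                      sumOver (box k b) h ≈ h (replicate k 0)
  sumOver-box-zeros zero    b h h≈0 = +-identityʳ _
  sumOver-box-zeros (suc k) b h h≈0 = begin
    sumOver (box (suc k) b) h ≈⟨ sumOver-box k b h ⟩
    sumOver (box k b) (λ α → h (0 ∷ α)) + ∑[ a < b ] sumOver (box k b) (λ α → h (suc (toℕ a) ∷ α))
      ≈⟨ +-cong (sumOver-box-zeros k b (λ α → h (0 ∷ α)) λ α α≢0 → h≈0 (0 ∷ α) λ { ≡.refl → α≢0 ≡.refl })
                (∑-zero {b} _ λ a → sumOver-zero (box k b) λ α → h≈0 _ λ ()) ⟩
    h (0 ∷ replicate k 0) + 0# ≈⟨ +-identityʳ _ ⟩
    h (0 ∷ replicate k 0)      ∎

  -- Raising maps the box onto its translate in direction `i`. The box loses the face with entry 0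
  -- and gains the one with entry `suc b`, and `h` vanishes on both. In the coordinate `i` this is
  -- `∑-shift`; the other coordinates are carried along.
  sumOver-box-raise : ∀ {k} b (i : Fin k) (h : Vec ℕ k → Carrier) →
    (∀ α → lookup α i ≡ 0 → h α ≈ 0#) → (∀ α → lookup α i ≡ suc b → h α ≈ 0#) →
    sumOver (box k b) h ≈ sumOver (box k b) (λ α → h (α [ i ]+1))
  sumOver-box-raise {suc k} b zero h h0≈0 hb≈0 = begin
    sumOver (box (suc k) b) h
      ≈⟨ sumOver-box k b h ⟩
    ∑[ a < suc b ] sumOver (box k b) (λ α → h (toℕ a ∷ α))
      ≈⟨ ∑-shift (suc b) (λ a → sumOver (box k b) (λ α → h (a ∷ α)))
           (sumOver-zero (box k b) λ α → h0≈0 _ ≡.refl) (sumOver-zero (box k b) λ α → hb≈0 _ ≡.refl) ⟩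
    ∑[ a < suc b ] sumOver (box k b) (λ α → h (suc (toℕ a) ∷ α))
      ≈⟨ sumOver-box k b (λ α → h (α [ zero ]+1)) ⟨
    sumOver (box (suc k) b) (λ α → h (α [ zero ]+1)) ∎
  sumOver-box-raise {suc k} b (suc i) h h0≈0 hb≈0 = begin
    sumOver (box (suc k) b) h
      ≈⟨ sumOver-box k b h ⟩
    ∑[ a < suc b ] sumOver (box k b) (λ α → h (toℕ a ∷ α))
      ≈⟨ sum-cong-≋ {suc b} (λ a → sumOver-box-raise b i (λ α → h (toℕ a ∷ α)) (λ α → h0≈0 _) (λ α → hb≈0 _)) ⟩
    ∑[ a < suc b ] sumOver (box k b) (λ α → h (toℕ a ∷ (α [ i ]+1)))
      ≈⟨ sumOver-box k b (λ α → h (α [ suc i ]+1)) ⟨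
    sumOver (box (suc k) b) (λ α → h (α [ suc i ]+1)) ∎

  -- The recurrence for the Fibonacci polynomials.

  monomial-zeros : ∀ k t → monomial t (replicate k 0) ≈ 1#
  monomial-zeros zero    t = refl
  monomial-zeros (suc k) t = trans (*-identityˡ _) (monomial-zeros k (t ∘ suc))

  monomial-raise : ∀ {k} t (α : Vec ℕ k) i → monomial t (α [ i ]+1) ≈ t (suc (toℕ i)) * monomial t α
  monomial-raise t (a ∷ α) zero    = *-assoc _ _ _
  monomial-raise t (a ∷ α) (suc i) = trans (*-congˡ (monomial-raise (t ∘ suc) α i)) (x∙yz≈y∙xz _ _ _)

  -- The i-th term of the recurrence xₙ = t₁ xₙ₋₁ + … + tₙ x₀, with i counted from 0.
  recurrenceTerm : (t x : ℕ → Carrier) → ℕ → ℕ → Carrier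
  recurrenceTerm t x n i = t (suc i) * x (n ∸ suc i) when (suc i ≤? n)

  module _ (t : ℕ → Carrier) (k b : ℕ) where

    fibonacciTerm : ℕ → Vec ℕ k → Carrier
    fibonacciTerm n α = multinomial α · monomial t α when (weight α ≟ n)

    -- F [ k ] n with the box of exponent vectors fixed independently of n.
    fibonacci : ℕ → Carrier
    fibonacci n = sumOver (box k b) (fibonacciTerm n)

    fibonacci-zero : fibonacci 0 ≈ 1#
    fibonacci-zero = begin
      fibonacci 0                ≈⟨ sumOver-box-zeros k b (fibonacciTerm 0) (λ α α≢0 →
                                      when-no (weight α ≟ 0) (α≢0 ∘ weightFrom≡0⇒zeros 1 α)) ⟩
      -- The decision is exchanged for an explicit `yes`, on which `_when_` computes.
      fibonacciTerm 0 0ᵏ         ≈⟨ when-cong (weight 0ᵏ ≟ 0) (yes (weightFrom-zeros 1 k)) id id (λ _ → refl) ⟩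
      multinomial 0ᵏ · monomial t 0ᵏ ≈⟨ ×-congˡ (multinomial-zeros k) ⟩
      -- This is what the multiple `1 · monomial t 0ᵏ` unfolds to.
      monomial t 0ᵏ + 0#         ≈⟨ +-identityʳ _ ⟩
      monomial t 0ᵏ              ≈⟨ monomial-zeros k t ⟩
      1#                         ∎
      where 0ᵏ = replicate k 0

    module _ (n : ℕ) (1+n≤b : suc n ≤ b) where

      termBelow : Fin k → Vec ℕ k → Carrier
      termBelow i α = multinomialBelow α i · monomial t α when (weight α ≟ suc n)

      fibonacciTerm-pascal : ∀ α → fibonacciTerm (suc n) α ≈ ∑[ i < k ] termBelow i α
      fibonacciTerm-pascal α = begin
        multinomial α · monomial t α when (weight α ≟ suc n)
          ≈⟨ when-cong (weight α ≟ suc n) (weight α ≟ suc n) id id pascal ⟩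
        sum (λ i → multinomialBelow α i · monomial t α) when (weight α ≟ suc n)
          ≈⟨ ∑-when (weight α ≟ suc n) (λ i → multinomialBelow α i · monomial t α) ⟩
        ∑[ i < k ] termBelow i α ∎
        where
        pascal : weight α ≡ suc n → multinomial α · monomial t α ≈ ∑[ i < k ] (multinomialBelow α i · monomial t α)
        pascal wα≡1+n = let s , Σα≡1+s = weightFrom≢0⇒sum≢0 1 α wα≡1+n in
          trans (×-congˡ (multinomial-pascal α s Σα≡1+s)) (·-∑ (multinomialBelow α) (monomial t α))

      -- Raising entry `i` adds `suc (toℕ i)` to the weight and a factor `t (suc (toℕ i))` to the
      -- monomial, while `multinomialBelow` becomes `multinomial α`. If `suc (toℕ i)` exceeds
      -- `suc n`, no raised vector has weight `suc n`, so both sides are zero.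
      termBelow-raise : ∀ i α → termBelow i (α [ i ]+1) ≈
        (t (suc (toℕ i)) * fibonacciTerm (suc n ∸ suc (toℕ i)) α when (suc (toℕ i) ≤? suc n))
      termBelow-raise i α with suc (toℕ i) ≤? suc n
      ... | no 1+i≰1+n = when-no (weight (α [ i ]+1) ≟ suc n) λ w≡1+n →
              1+i≰1+n (ℕ.m+n≤o⇒m≤o _ (ℕ.≤-reflexive (≡.trans (≡.sym (weightFrom-raise 1 α i)) w≡1+n)))
      ... | yes (s≤s i≤n) = begin
        termBelow i (α [ i ]+1)
          ≈⟨ when-cong (weight (α [ i ]+1) ≟ suc n) (weight α ≟ n ∸ toℕ i)
               (λ w≡1+n → ≡.trans (≡.sym (ℕ.m+n∸m≡n (toℕ i) _)) (≡.cong (_∸ toℕ i) (ℕ.suc-injective (≡.trans (≡.sym (weightFrom-raise 1 α i)) w≡1+n))))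
               (λ w≡n∸i → ≡.trans (weightFrom-raise 1 α i) (≡.cong suc (≡.trans (≡.cong (toℕ i ℕ.+_) w≡n∸i) (ℕ.m+[n∸m]≡n i≤n))))
               (λ _ → value) ⟩
        (t (suc (toℕ i)) * (multinomial α · monomial t α) when (weight α ≟ n ∸ toℕ i))
          ≈⟨ *-when (weight α ≟ n ∸ toℕ i) _ _ ⟩
        t (suc (toℕ i)) * fibonacciTerm (n ∸ toℕ i) α ∎
        where
        value : multinomialBelow (α [ i ]+1) i · monomial t (α [ i ]+1) ≈ t (suc (toℕ i)) * (multinomial α · monomial t α)
        value = begin
          multinomialBelow (α [ i ]+1) i · monomial t (α [ i ]+1) ≈⟨ ×-congˡ (multinomialBelow-raise α i) ⟩
          multinomial α · monomial t (α [ i ]+1)                  ≈⟨ ×-congʳ (multinomial α) (monomial-raise t α i) ⟩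
          multinomial α · (t (suc (toℕ i)) * monomial t α)        ≈⟨ ×-comm-* (multinomial α) _ _ ⟨
          t (suc (toℕ i)) * (multinomial α · monomial t α)        ∎

      sumOver-termBelow : ∀ i → sumOver (box k b) (termBelow i) ≈ recurrenceTerm t fibonacci (suc n) (toℕ i)
      sumOver-termBelow i = begin
        sumOver (box k b) (termBelow i)
          ≈⟨ sumOver-box-raise b i (termBelow i)
               (λ α αᵢ≡0 → when-zero (weight α ≟ suc n) λ _ → ×-congˡ (multinomialBelow-zero α i αᵢ≡0))
               -- An entry `suc b` makes the weight at least `suc b`, which is more than `suc n` by
               -- the bound `1+n≤b`.
               (λ α αᵢ≡1+b → when-no (weight α ≟ suc n) λ w≡1+n → ℕ.<⇒≱ (s≤s 1+n≤b)
                 (≡.subst₂ _≤_ αᵢ≡1+b w≡1+n (lookup≤weightFrom 1 α i))) ⟩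
        sumOver (box k b) (λ α → termBelow i (α [ i ]+1))
          ≈⟨ sumOver-cong (box k b) (termBelow-raise i) ⟩
        sumOver (box k b) (λ α → t (suc (toℕ i)) * fibonacciTerm (suc n ∸ suc (toℕ i)) α when (suc (toℕ i) ≤? suc n))
          ≈⟨ pull-out (suc (toℕ i) ≤? suc n) ⟩
        recurrenceTerm t fibonacci (suc n) (toℕ i) ∎
        where
        -- Stated for an arbitrary decision, so that one match reduces both sides.
        pull-out : {P : Set} (P? : Dec P) →
          sumOver (box k b) (λ α → t (suc (toℕ i)) * fibonacciTerm (n ∸ toℕ i) α when P?) ≈
          (t (suc (toℕ i)) * fibonacci (n ∸ toℕ i) when P?)
        pull-out (yes _) = sumOver-* (box k b) _ _
        pull-out (no  _) = sumOver-zero (box k b) λ _ → refl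

      fibonacci-recurrence : fibonacci (suc n) ≈ ∑[ i < k ] recurrenceTerm t fibonacci (suc n) (toℕ i)
      fibonacci-recurrence = begin
        fibonacci (suc n)                                     ≈⟨ sumOver-cong (box k b) fibonacciTerm-pascal ⟩
        sumOver (box k b) (λ α → ∑[ i < k ] termBelow i α)    ≈⟨ sumOver-∑ (box k b) termBelow ⟩
        ∑[ i < k ] sumOver (box k b) (termBelow i)            ≈⟨ sum-cong-≋ sumOver-termBelow ⟩
        ∑[ i < k ] recurrenceTerm t fibonacci (suc n) (toℕ i) ∎

    -- Strong induction along the common recurrence. The two versions differ only in length, `k`
    -- terms against `suc n`: terms beyond `k` vanish with `t`, and terms beyond `suc n` vanish by
    -- the side condition in `recurrenceTerm`. Bounding `j` by `b` lets the same lemma serve both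
    -- finite and infinite core degree.
    fibonacci-unique : (∀ j → k < j → j ≤ b → t j ≈ 0#) →
      (x : ℕ → Carrier) → x 0 ≈ 1# → (∀ n → x (suc n) ≈ ∑[ i < suc n ] recurrenceTerm t x (suc n) (toℕ i)) →
      ∀ n → n ≤ b → fibonacci n ≈ x n
    fibonacci-unique t≈0 x x0≈1 x-recurrence = <-rec (λ n → n ≤ b → fibonacci n ≈ x n) step
      where
      step : ∀ n → (∀ {m} → m < n → m ≤ b → fibonacci m ≈ x m) → n ≤ b → fibonacci n ≈ x n
      step zero    ih _     = trans fibonacci-zero (sym x0≈1)
      step (suc n) ih 1+n≤b = begin
        fibonacci (suc n)                                     ≈⟨ fibonacci-recurrence n 1+n≤b ⟩
        ∑[ i < k ] recurrenceTerm t fibonacci (suc n) (toℕ i) ≈⟨ sum-cong-≋ {k} (λ i → term (toℕ i)) ⟩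
        ∑[ i < k ] recurrenceTerm t x (suc n) (toℕ i)         ≈⟨ change-range ⟩
        ∑[ i < suc n ] recurrenceTerm t x (suc n) (toℕ i)     ≈⟨ x-recurrence n ⟨
        x (suc n)                                             ∎
        where
        term : ∀ i → recurrenceTerm t fibonacci (suc n) i ≈ recurrenceTerm t x (suc n) i
        term i = when-cong (suc i ≤? suc n) (suc i ≤? suc n) id id λ _ →
          *-congˡ (ih (s≤s (ℕ.m∸n≤m n i)) (ℕ.≤-trans (ℕ.m∸n≤m n i) (ℕ.<⇒≤ 1+n≤b)))

        change-range : ∑[ i < k ] recurrenceTerm t x (suc n) (toℕ i) ≈ ∑[ i < suc n ] recurrenceTerm t x (suc n) (toℕ i)
        change-range with ℕ.≤-total k (suc n)
        ... | inj₁ k≤1+n = sym (∑-truncate (recurrenceTerm t x (suc n)) k≤1+n λ i k≤i i<1+n →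
                when-zero (suc i ≤? suc n) λ _ → trans (*-congʳ (t≈0 (suc i) (s≤s k≤i) (ℕ.≤-trans i<1+n 1+n≤b))) (zeroˡ _))
        ... | inj₂ 1+n≤k = ∑-truncate (recurrenceTerm t x (suc n)) 1+n≤k λ i 1+n≤i _ →
                when-no (suc i ≤? suc n) (ℕ.<⇒≱ (s≤s 1+n≤i))

  F-polynomial : ∀ t k n → F [ k ] n t ≈ fibonacci t k n n
  F-polynomial t k zero    = sym (fibonacci-zero t k 0)
  F-polynomial t k (suc n) = sumOver-filter (λ α → weight α ≟ suc n) (box k (suc n)) _

  F-power-series : ∀ t n → F ⊤⁺ n t ≈ fibonacci t n n n
  F-power-series t zero    = sym (fibonacci-zero t 0 0)
  -- For a positive argument, degree infinity and degree `suc n` unfold to the same sum.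
  F-power-series t (suc n) = F-polynomial t (suc n) (suc n)

  -- Dirichlet convolution at prime powers.

  -- Index `i` stands for the number `suc i`, hence the `pred`. By induction on `n`, among the
  -- numbers above one power of `p` and up to the next only the last, at index `M`, contributes.
  ∑-powers : ∀ {p} → 1 < p → (g : ℕ → Carrier) → (∀ i → (∀ j → suc i ≢ p ℕ.^ j) → g i ≈ 0#) →
             ∀ n → ∑[ i < p ℕ.^ n ] g (toℕ i) ≈ ∑[ j < suc n ] g (pred (p ℕ.^ toℕ j))
  ∑-powers {p} 1<p g g≈0 zero    = refl
  ∑-powers {p} 1<p g g≈0 (suc n) = begin
    ∑[ i < p ℕ.^ suc n ] g (toℕ i)                                 ≡⟨ ≡.cong (λ m → ∑[ i < m ] g (toℕ i)) 1+M≡ ⟨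
    ∑[ i < suc M ] g (toℕ i)                                       ≈⟨ ∑-suc M g ⟩
    ∑[ i < M ] g (toℕ i) + g M                                     ≈⟨ +-congʳ (∑-truncate g pⁿ≤M λ i pⁿ≤i i<M →
                                                                        g≈0 i (between-powers 1<p {n} (s≤s pⁿ≤i) (≡.subst (suc i <_) 1+M≡ (s<s i<M)))) ⟩
    ∑[ i < p ℕ.^ n ] g (toℕ i) + g M                               ≈⟨ +-congʳ (∑-powers 1<p g g≈0 n) ⟩
    ∑[ j < suc n ] g (pred (p ℕ.^ toℕ j)) + g M                    ≈⟨ ∑-suc (suc n) (λ j → g (pred (p ℕ.^ j))) ⟨
    ∑[ j < suc (suc n) ] g (pred (p ℕ.^ toℕ j))                    ∎
    where
    M = pred (p ℕ.^ suc n)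
    instance
      p≢0 : NonZero p
      p≢0 = >-nonZero (ℕ.<-trans z<s 1<p)
    1+M≡ : suc M ≡ p ℕ.^ suc n
    1+M≡ = ℕ.suc-pred (p ℕ.^ suc n) {{m^n≢0 p (suc n)}}
    pⁿ≤M : p ℕ.^ n ≤ M
    pⁿ≤M = s≤s⁻¹ (≡.subst (p ℕ.^ n <_) (≡.sym 1+M≡) (ℕ.^-monoʳ-< p 1<p (ℕ.n<1+n n)))

  module _ (α β : ArithmeticFunction) where

    arithmetic-cong : ∀ (γ : ArithmeticFunction) {m n} .{{_ : NonZero m}} .{{_ : NonZero n}} → m ≡ n → γ m ≈ γ n
    arithmetic-cong γ ≡.refl = refl

    divisorTerm-divisor : ∀ n .{{_ : NonZero n}} d .{{_ : NonZero d}} q .{{_ : NonZero q}} → d ℕ.* q ≡ n →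
                          divisorTerm α β n d ≈ α d * β q
    divisorTerm-divisor n d q dq≡n with d ∣? n
    ... | no  d∤n = contradiction (divides q (≡.trans (≡.sym dq≡n) (ℕ.*-comm d q))) d∤n
    ... | yes d∣n = *-congˡ (arithmetic-cong β {{quotient≢0 d∣n}}
      (ℕ.*-cancelʳ-≡ (quotient d∣n) q d (≡.trans (≡.sym (_∣_.equality d∣n)) (≡.trans (≡.sym dq≡n) (ℕ.*-comm d q)))))

    divisorTerm-nondivisor : ∀ n .{{_ : NonZero n}} d .{{_ : NonZero d}} → ¬ d ∣ n → divisorTerm α β n d ≈ 0#
    divisorTerm-nondivisor n d d∤n with d ∣? n
    ... | yes d∣n = contradiction d∣n d∤n
    ... | no  _   = refl

    convolution-at-prime-power : ∀ {p} (pr : Prime p) n →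
      atPrimePower (α ∗ β) pr n ≈ ∑[ j < suc n ] (atPrimePower α pr (n ∸ toℕ j) * atPrimePower β pr (toℕ j))
    convolution-at-prime-power {p} pr n = begin
      ∑[ i < p ℕ.^ n ] g (toℕ i)                                                    ≈⟨ ∑-powers 1<p g nonpower n ⟩
      -- Reversing the sum over the divisors makes `j` the exponent in the argument of `β`, the
      -- order in which the parameters enter the recurrence.
      ∑[ j < suc n ] g (pred (p ℕ.^ toℕ j))                                         ≈⟨ ∑-permute (λ j → g (pred (p ℕ.^ toℕ j))) (reverse {suc n}) ⟩
      ∑[ j < suc n ] g (pred (p ℕ.^ toℕ (opposite j)))                              ≈⟨ sum-cong-≋ power ⟩
      ∑[ j < suc n ] (atPrimePower α pr (n ∸ toℕ j) * atPrimePower β pr (toℕ j))    ∎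
      where
      pⁿ≢0 : ∀ m → NonZero (p ℕ.^ m)
      pⁿ≢0 m = m^n≢0 p m {{prime⇒nonZero pr}}
      1<p : 1 < p
      1<p = nonTrivial⇒n>1 p {{prime⇒nonTrivial pr}}
      g : ℕ → Carrier
      g i = divisorTerm α β (p ℕ.^ n) {{pⁿ≢0 n}} (suc i)

      nonpower : ∀ i → (∀ j → suc i ≢ p ℕ.^ j) → g i ≈ 0#
      nonpower i 1+i≢pʲ = divisorTerm-nondivisor (p ℕ.^ n) {{pⁿ≢0 n}} (suc i) λ { (divides q pⁿ≡q[1+i]) →
        let j , 1+i≡pʲ = divisor-of-prime-power pr n (suc i) q (≡.trans (ℕ.*-comm (suc i) q) (≡.sym pⁿ≡q[1+i]))
        in 1+i≢pʲ j 1+i≡pʲ }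

      power : ∀ (j : Fin (suc n)) → g (pred (p ℕ.^ toℕ (opposite j))) ≈ atPrimePower α pr (n ∸ toℕ j) * atPrimePower β pr (toℕ j)
      power j = trans
        (divisorTerm-divisor (p ℕ.^ n) {{pⁿ≢0 n}} (suc (pred (p ℕ.^ toℕ (opposite j)))) (p ℕ.^ toℕ j) {{pⁿ≢0 (toℕ j)}} (≡.trans (≡.cong (ℕ._* p ℕ.^ toℕ j) d≡)
          (≡.trans (≡.sym (ℕ.^-distribˡ-+-* p (n ∸ toℕ j) (toℕ j))) (≡.cong (p ℕ.^_) (ℕ.m∸n+n≡m (s≤s⁻¹ (toℕ<n j)))))))
        (*-congʳ (arithmetic-cong α {{_}} {{pⁿ≢0 (n ∸ toℕ j)}} d≡))
        where
        d≡ : suc (pred (p ℕ.^ toℕ (opposite j))) ≡ p ℕ.^ (n ∸ toℕ j)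
        d≡ = ≡.trans (ℕ.suc-pred _ {{pⁿ≢0 (toℕ (opposite j))}}) (≡.cong (p ℕ.^_) (opposite-prop j))

  -- The recurrence for the values at prime powers.

  δ-≢1 : ∀ n .{{_ : NonZero n}} → n ≢ 1 → δ n ≈ 0#
  δ-≢1 0             _   = refl
  δ-≢1 1             1≢1 = contradiction ≡.refl 1≢1
  δ-≢1 (suc (suc n)) _   = refl

  module _ {p : ℕ} (pr : Prime p) {χ : ArithmeticFunction} (mult : IsMultiplicative χ)
           {χ⁻¹ : ArithmeticFunction} (inverse : IsConvolutionInverse χ χ⁻¹) where

    private
      x y t : ℕ → Carrier
      x = atPrimePower χ pr
      y = atPrimePower χ⁻¹ pr
      t = parameters χ⁻¹ pr

    -- The sum of all `x (n ∸ i) * y (suc i)` is added to both sides. The left side becomes the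
    -- convolution of `χ` and `χ⁻¹` at a prime power greater than 1, which is zero; the right side
    -- cancels term by term, since the parameters are the negatives of the values of `y`.
    atPrimePower-recurrence : ∀ n → x (suc n) ≈ ∑[ i < suc n ] recurrenceTerm t x (suc n) (toℕ i)
    atPrimePower-recurrence n = +-cancelʳ (∑[ i < suc n ] (x (n ∸ toℕ i) * y (suc (toℕ i)))) _ _ (begin
      x (suc n) + ∑[ i < suc n ] (x (n ∸ toℕ i) * y (suc (toℕ i)))
        ≈⟨ +-congʳ (trans (*-congˡ y0≈1) (*-identityʳ _)) ⟨
      ∑[ i < suc (suc n) ] (x (suc n ∸ toℕ i) * y (toℕ i))
        ≈⟨ convolution-at-prime-power χ χ⁻¹ pr (suc n) ⟨
      atPrimePower (χ ∗ χ⁻¹) pr (suc n)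
        ≈⟨ inverse (p ℕ.^ suc n) {{pⁿ≢0 (suc n)}} ⟩
      δ (p ℕ.^ suc n) {{pⁿ≢0 (suc n)}}
        ≈⟨ δ-≢1 (p ℕ.^ suc n) {{pⁿ≢0 (suc n)}} (ℕ.>⇒≢ (ℕ.^-monoʳ-< p 1<p {0} {suc n} z<s)) ⟩
      0#
        ≈⟨ ∑-zero _ cancel ⟨
      ∑[ i < suc n ] (recurrenceTerm t x (suc n) (toℕ i) + x (n ∸ toℕ i) * y (suc (toℕ i)))
        ≈⟨ ∑-distrib-+ (λ i → recurrenceTerm t x (suc n) (toℕ i)) (λ (i : Fin (suc n)) → x (n ∸ toℕ i) * y (suc (toℕ i))) ⟩
      ∑[ i < suc n ] recurrenceTerm t x (suc n) (toℕ i) + ∑[ i < suc n ] (x (n ∸ toℕ i) * y (suc (toℕ i))) ∎)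
      where
      1<p : 1 < p
      1<p = nonTrivial⇒n>1 p {{prime⇒nonTrivial pr}}

      pⁿ≢0 : ∀ m → NonZero (p ℕ.^ m)
      pⁿ≢0 m = m^n≢0 p m {{prime⇒nonZero pr}}

      y0≈1 : y 0 ≈ 1#
      y0≈1 = begin
        y 0             ≈⟨ *-identityˡ _ ⟨
        1# * y 0        ≈⟨ *-congʳ (χ1≈1 mult) ⟨
        -- The convolution at 1 has a single term, and `p ^ 0` computes to 1.
        x 0 * y 0       ≈⟨ divisorTerm-divisor χ χ⁻¹ 1 1 1 ≡.refl ⟨
        divisorTerm χ χ⁻¹ 1 1 ≈⟨ +-identityʳ _ ⟨
        (χ ∗ χ⁻¹) 1     ≈⟨ inverse 1 ⟩
        1#              ∎

      cancel : ∀ (i : Fin (suc n)) → recurrenceTerm t x (suc n) (toℕ i) + x (n ∸ toℕ i) * y (suc (toℕ i)) ≈ 0#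
      cancel i = begin
        recurrenceTerm t x (suc n) (toℕ i) + x (n ∸ toℕ i) * y (suc (toℕ i))
          ≈⟨ +-cong (when-cong (suc (toℕ i) ≤? suc n) (yes (toℕ<n i)) id id λ _ → refl) (*-comm _ _) ⟩
        - y (suc (toℕ i)) * x (n ∸ toℕ i) + y (suc (toℕ i)) * x (n ∸ toℕ i)
          ≈⟨ distribʳ _ _ _ ⟨
        (- y (suc (toℕ i)) + y (suc (toℕ i))) * x (n ∸ toℕ i)
          ≈⟨ *-congʳ (-‿inverseˡ _) ⟩
        0# * x (n ∸ toℕ i)
          ≈⟨ zeroˡ _ ⟩
        0# ∎

theorem1 : ∀ {c ℓ₁ ℓ₂} (K : HeytingField c ℓ₁ ℓ₂) → let open HeytingField K in let open Over K in
    (p : ℕ) (pr : Prime p)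
    (χ : ArithmeticFunction) → IsMultiplicative χ →
    (χ⁻¹ : ArithmeticFunction) → IsConvolutionInverse χ χ⁻¹ →
    (k : ℕ ⁺) → IsCoreDegree (parameters χ⁻¹ pr) k →
    ∀ n → F k n (parameters χ⁻¹ pr) ≈ atPrimePower χ pr n
theorem1 K p pr χ mult χ⁻¹ inverse [ k ] core n = HeytingField.trans K (F-polynomial K t k n)
  -- The bound of the box is `n` itself, as in `exponents k n`.
  (fibonacci-unique K t k n (λ j k<j _ → Over.IsPolynomialCore.above core j k<j)
    _ (Over.χ1≈1 K mult) (atPrimePower-recurrence K pr mult inverse) n ℕ.≤-refl)
  where t = Over.parameters K χ⁻¹ pr
theorem1 K p pr χ mult χ⁻¹ inverse ⊤⁺ _ n = HeytingField.trans K (F-power-series K t n)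
  -- Vector length and box bound are both `n`, so the vanishing condition concerns only `j` with
  -- `n < j` and `j ≤ n`, and there are none.
  (fibonacci-unique K t n n (λ j n<j j≤n → contradiction j≤n (ℕ.<⇒≱ n<j))
    _ (Over.χ1≈1 K mult) (atPrimePower-recurrence K pr mult inverse) n ℕ.≤-refl)
  where t = Over.parameters K χ⁻¹ pr
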